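{- Let $n\ge 7$ and let $f:E(K_{n,n})\to\{1,2\}$ be a coloring of the edges of the complete bipartite graph $K_{n,n}$. If $|f^{ -1}(i)|\ge 2n-1$ for $i=1,2$, then there exists a partition of $E(K_{n,n})$ into $n$ pairwise disjoint balanced matchings.
   Context: Given an edge coloring $f:E(K_{n,n})\to\{1,2\}$, a matching $P\subset E(K_{n,n})$ is balanced if $f^{ -1}(i)\cap P\neq\emptyset$ for $i=1,2$. -}

module Defs where

open import Data.Nat using (ℕ)
open import Data.Fin using (Fin)
open import Data.Fin.Properties using (_≟_)
open import Data.List using (List; length; filter; allFin; cartesianProduct)
open import Data.Product using (Σ; _×_; _,_; ∃-syntax; proj₁; proj₂)
open import Relation.Binary.PropositionalEquality using (_≡_; refl)
open import Relation.Nullary using (¬_; Dec; yes; no)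

data Colour : Set where
  c1 c2 : Colour

-- Edges of K_{n,n}: pairs (u , v) with u in the left part, v in the right part.
Edge : ℕ → Set
Edge n = Fin n × Fin n

Colouring : ℕ → Set
Colouring n = Edge n → Colour

isC : (c : Colour) → (d : Colour) → Dec (d ≡ c)
isC c1 c1 = yes refl
isC c1 c2 = no (λ ())
isC c2 c1 = no (λ ())
isC c2 c2 = yes refl

edges : (n : ℕ) → List (Edge n)
edges n = cartesianProduct (allFin n) (allFin n)

colourClassSize : {n : ℕ} → Colouring n → Colour → ℕ
colourClassSize {n} f c = length (filter (λ e → isC c (f e)) (edges n))

IsMatching : {n : ℕ} → (Edge n → Set) → Set
IsMatching {n} P = ∀ (e e' : Edge n) → P e → P e' → ¬ (e ≡ e') →
  ¬ (proj₁ e ≡ proj₁ e') × ¬ (proj₂ e ≡ proj₂ e')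

IsBalanced : {n : ℕ} → Colouring n → (Edge n → Set) → Set
IsBalanced {n} f P = (∃[ e ] (P e × f e ≡ c1)) × (∃[ e ] (P e × f e ≡ c2))

-- A partition of E(K_{n,n}) into n pairwise disjoint balanced matchings:
-- a map assigning each edge to exactly one of n classes (so the classes are
-- pairwise disjoint and cover all edges), each class being a balanced matching.
PartitionIntoBalancedMatchings : {n : ℕ} → Colouring n → Set
PartitionIntoBalancedMatchings {n} f =
  Σ (Edge n → Fin n) λ g → (k : Fin n) →
    IsMatching (λ e → g e ≡ k) × IsBalanced f (λ e → g e ≡ k)

{-# OPTIONS --safe #-}

-- A partition into n matchings is a Latin square whose symbols are the classes; every symbol has to occur
-- in cells of both colours.  Deleting columns and rows alternately, always a line with few cells of the
-- minority colour, keeps both colours at no fewer than k + l - 1 cells in the remaining k × l block.  Stop at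
-- an r × s block with r + s = n + 1: it contains n cells of each colour.  Pair these n cells of colour 1
-- with n cells of colour 2 so that paired cells lie on no common line (Hall's condition holds because two
-- classes of cells that meet completely have fewer than r + s members), and write symbol k into the k-th
-- pair.  A cell of the block has r + s - 2 < n neighbours, so the block can be filled greedily, and as
-- every symbol occurs in it, Ryser's theorem completes it to a Latin square.  The completion consists of two
-- applications of König's edge colouring theorem, proved with Kempe chains.
module Submission where

open import Defs
open import Data.Nat using (ℕ; _≤_; _*_; _∸_)
open import Data.Product using (_×_)
open import Algebra.Properties.CommutativeMonoid.Sum using ()
open import Data.Bool using (Bool; true; false; if_then_else_)
open import Data.Empty using (⊥; ⊥-elim)
open import Data.Fin using (Fin; zero; suc; splitAt; join; punchIn; inject≤)
open import Data.Fin.Patterns using (0F; 1F; 2F; 3F)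
open import Data.Fin.Permutation.Components using (transpose; transpose-inverse)
open import Data.Fin.Properties using (_≟_; any?; all?; injective⇒≤; splitAt-join; join-splitAt; ¬∀⟶∃¬; punchIn-injective; punchInᵢ≢i; inject≤-injective)
open import Data.Fin.Subset using (Subset; _∈_; _∉_; _∪_; ⁅_⁆)
open import Data.Fin.Subset.Induction using (⊃-wellFounded)
open import Data.Fin.Subset.Properties using (_∈?_; p⊆p∪q; q⊆p∪q; x∈p∪q⁻; x∈⁅x⁆; x∈⁅y⁆⇒x≡y)
open import Data.List using (List; []; _∷_; _++_; map; length; filter; allFin; tabulate; cartesianProduct; lookup)
open import Data.List.Membership.Propositional using () renaming (_∈_ to _∈ˡ_)
open import Data.List.Membership.Propositional.Properties using (∈-allFin; ∈-cartesianProduct⁺; ∈-lookup; ∈-filter⁻)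
open import Data.List.Properties using (length-++; filter-++)
open import Data.List.Relation.Unary.All as All using ()
open import Data.List.Relation.Unary.AllPairs using (_∷_)
open import Data.List.Relation.Unary.Any using (here; there)
open import Data.List.Relation.Unary.Unique.Propositional using (Unique)
import Data.List.Relation.Unary.Unique.Propositional.Properties as Unique
open import Data.Maybe using (Maybe; just; nothing) renaming (map to mapᴹ)
open import Data.Maybe.Properties using (just-injective; ≡-dec)
open import Data.Nat using (zero; suc; _+_; _<_; z≤n; s≤s; _≤?_)
open import Data.Nat.Divisibility using (_∣_; ∣m∣n⇒∣m+n; ∣-refl; _∣0; _∣?_)
open import Data.Nat.Properties hiding (_≟_)
open import Data.Nat.Tactic.RingSolver using (solve-∀)
open import Data.Product using (Σ; _,_; ∃; proj₁; proj₂; swap)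
open import Data.Product.Properties using () renaming (≡-dec to ×-≡-dec)
open import Data.Sum as Sum using (_⊎_; inj₁; inj₂; [_,_]′)
open import Data.Sum.Properties using (inj₁-injective; inj₂-injective)
open import Data.Vec.Functional using (removeAt)
open import Function using (_∘_; case_of_; id)
open import Function.Definitions using (Injective)
open import Induction.WellFounded using (Acc; acc)
open import Relation.Binary.PropositionalEquality using (_≡_; _≢_; refl; sym; trans; cong; cong₂; subst; subst₂; module ≡-Reasoning)
open import Relation.Nullary using (¬_; Dec; yes; no; does; contradiction)
open import Relation.Nullary.Decidable using (_×-dec_; _⊎-dec_; ¬?; decidable-stable; from-no)

open Algebra.Properties.CommutativeMonoid.Sum +-0-commutativeMonoid
  using (sum; sum-remove; ∑-distrib-+; ∑-comm)

-- Injections of finite sets; finite iteration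

Inj : {A B : Set} → (A → B) → Set
Inj = Injective _≡_ _≡_

⊎-injective⇒≤ : ∀ {a b n} (f : Fin a ⊎ Fin b → Fin n) → Inj f → a + b ≤ n
⊎-injective⇒≤ {a} {b} f f-inj = injective⇒≤ {f = f ∘ splitAt a} λ {x} {y} eq →
  trans (sym (join-splitAt a b x)) (trans (cong (join a b) (f-inj eq)) (join-splitAt a b y))

injective⇒≤-⊎ : ∀ {m a b} (f : Fin m → Fin a ⊎ Fin b) → Inj f → m ≤ a + b
injective⇒≤-⊎ {m} {a} {b} f f-inj = injective⇒≤ {f = join a b ∘ f} λ {x} {y} eq →
  f-inj (trans (sym (splitAt-join a b (f x))) (trans (cong (splitAt a) eq) (splitAt-join a b (f y))))

injective⇒surjective : ∀ {n} (f : Fin n → Fin n) → Inj f → ∀ y → ∃ λ x → f x ≡ y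
injective⇒surjective {n} f f-inj y with any? (λ x → f x ≟ y)
... | yes p = p
... | no ¬p = contradiction (injective⇒≤ {f = g} g-inj) 1+n≰n
  where
  g : Fin (suc n) → Fin n
  g zero    = y
  g (suc x) = f x
  g-inj : Inj g
  g-inj {zero}  {zero}  _  = refl
  g-inj {zero}  {suc x} eq = ⊥-elim (¬p (x , sym eq))
  g-inj {suc x} {zero}  eq = ⊥-elim (¬p (x , eq))
  g-inj {suc x} {suc z} eq = cong suc (f-inj eq)

-- Each step settles one item and undoes none, so one pass settles all. Edge colouring, greedy
-- filling and matching augmentation are all run this way.
sweep : {S C : Set} (Done : S → C → Set) →
        (∀ s c → ∃ λ s′ → Done s′ c × (∀ c′ → Done s c′ → Done s′ c′)) →
        ∀ (L : List C) s → ∃ λ s′ → (∀ {c} → c ∈ˡ L → Done s′ c) × (∀ c′ → Done s c′ → Done s′ c′)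
sweep Done step []      s = s , (λ ()) , λ _ d → d
sweep Done step (c ∷ L) s with step s c
... | s₁ , done , keep with sweep Done step L s₁
... | s₂ , dones , keeps =
  s₂ , (λ { (here refl) → keeps c done ; (there c∈L) → dones c∈L }) , λ c′ d → keeps c′ (keep c′ d)

sweep² : ∀ {a b} {S : Set} (Done : S → Fin a → Fin b → Set) →
         (∀ s u v → ∃ λ s′ → Done s′ u v × (∀ i j → Done s i j → Done s′ i j)) →
         S → ∃ λ s → ∀ i j → Done s i j
sweep² {a} {b} Done step s
  with sweep (λ t c → Done t (proj₁ c) (proj₂ c))
         (λ t c → case step t (proj₁ c) (proj₂ c) of λ { (t′ , d , k) → t′ , d , λ c′ → k (proj₁ c′) (proj₂ c′) })
         (cartesianProduct (allFin a) (allFin b)) s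
... | s′ , done , _ = s′ , λ i j → done (∈-cartesianProduct⁺ (∈-allFin i) (∈-allFin j))

-- Terminates because a subset of `Fin n` cannot grow forever. Kempe chains and alternating paths
-- are both built by it.
grow : ∀ {n} (Inv Closed : Subset n → Set) →
       (∀ X → Inv X → Closed X ⊎ ∃ λ z → z ∉ X × Inv (X ∪ ⁅ z ⁆)) →
       ∀ X → Inv X → ∃ λ Y → Inv Y × Closed Y
grow {n} Inv Closed step X = go X (⊃-wellFounded X)
  where
  go : ∀ X → Acc _ X → Inv X → ∃ λ Y → Inv Y × Closed Y
  go X (acc rs) inv with step X inv
  ... | inj₁ closed = X , inv , closed
  ... | inj₂ (z , z∉X , inv′) =
    go (X ∪ ⁅ z ⁆) (rs ((λ {x} → p⊆p∪q ⁅ z ⁆) , z , q⊆p∪q X ⁅ z ⁆ (x∈⁅x⁆ z) , z∉X)) inv′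

-- König's edge colouring theorem

module _ {a b Δ : ℕ} where

  -- An edge colouring of a bipartite graph, kept as an array indexed by the two parts; `nothing`
  -- marks a cell not coloured.
  PartialColouring : Set
  PartialColouring = Fin a → Fin b → Maybe (Fin Δ)

  record Proper (φ : PartialColouring) : Set where
    field
      row : ∀ {i j j′ k} → φ i j ≡ just k → φ i j′ ≡ just k → j ≡ j′
      col : ∀ {i i′ j k} → φ i j ≡ just k → φ i′ j ≡ just k → i ≡ i′

  FreeAtRow : PartialColouring → Fin a → Fin Δ → Set
  FreeAtRow φ u k = ∀ j → φ u j ≢ just k

  FreeAtCol : PartialColouring → Fin b → Fin Δ → Set
  FreeAtCol φ v k = ∀ i → φ i v ≢ just k

  assign : PartialColouring → Fin a → Fin b → Fin Δ → PartialColouring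
  assign φ u v k i j with (i ≟ u) ×-dec (j ≟ v)
  ... | yes _ = just k
  ... | no  _ = φ i j

  assign-here : ∀ φ u v k → assign φ u v k u v ≡ just k
  assign-here φ u v k with (u ≟ u) ×-dec (v ≟ v)
  ... | yes _ = refl
  ... | no ¬p = ⊥-elim (¬p (refl , refl))

  assign-keeps : ∀ φ u v k {i j l} → φ u v ≡ nothing → φ i j ≡ just l → assign φ u v k i j ≡ just l
  assign-keeps φ u v k {i} {j} e p with (i ≟ u) ×-dec (j ≟ v)
  ... | yes (refl , refl) = case trans (sym e) p of λ ()
  ... | no  _ = p

  assign⁻ : ∀ φ u v k i j {l} → assign φ u v k i j ≡ just l →
            (i ≡ u × j ≡ v × l ≡ k) ⊎ φ i j ≡ just l
  assign⁻ φ u v k i j p with (i ≟ u) ×-dec (j ≟ v)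
  ... | yes (i≡u , j≡v) = inj₁ (i≡u , j≡v , sym (just-injective p))
  ... | no  _ = inj₂ p

  assign-proper : ∀ {φ u v k} → Proper φ → FreeAtRow φ u k → FreeAtCol φ v k → Proper (assign φ u v k)
  assign-proper {φ} {u} {v} {k} φ-proper free-u free-v = record
    { row = λ {i} {j} {j′} → row′ {i} {j} {j′}
    ; col = λ {i} {i′} {j} → col′ {i} {i′} {j} }
    where
    open Proper φ-proper
    row′ : ∀ {i j j′ l} → assign φ u v k i j ≡ just l → assign φ u v k i j′ ≡ just l → j ≡ j′
    row′ {i} {j} {j′} p q with assign⁻ φ u v k i j p | assign⁻ φ u v k i j′ q
    ... | inj₁ (_ , refl , _)       | inj₁ (_ , refl , _)       = refl
    ... | inj₁ (refl , refl , refl) | inj₂ q′                   = ⊥-elim (free-u _ q′)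
    ... | inj₂ p′                   | inj₁ (refl , refl , refl) = ⊥-elim (free-u _ p′)
    ... | inj₂ p′                   | inj₂ q′                   = row p′ q′
    col′ : ∀ {i i′ j l} → assign φ u v k i j ≡ just l → assign φ u v k i′ j ≡ just l → i ≡ i′
    col′ {i} {i′} {j} p q with assign⁻ φ u v k i j p | assign⁻ φ u v k i′ j q
    ... | inj₁ (refl , _ , _)       | inj₁ (refl , _ , _)       = refl
    ... | inj₁ (refl , refl , refl) | inj₂ q′                   = ⊥-elim (free-v _ q′)
    ... | inj₂ p′                   | inj₁ (refl , refl , refl) = ⊥-elim (free-v _ p′)
    ... | inj₂ p′                   | inj₂ q′                   = col p′ q′

transpose-cases : ∀ {n} (α β k : Fin n) →
  (k ≡ α × transpose α β k ≡ β) ⊎ (k ≡ β × transpose α β k ≡ α) ⊎ (k ≢ α × transpose α β k ≡ k)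
transpose-cases α β k with k ≟ α
... | yes k≡α = inj₁ (k≡α , refl)
... | no  k≢α with k ≟ β
...   | yes k≡β = inj₂ (inj₁ (k≡β , refl))
...   | no  _   = inj₂ (inj₂ (k≢α , refl))

transpose-injective : ∀ {n} (α β : Fin n) → Inj (transpose α β)
transpose-injective α β {x} {y} eq =
  trans (sym (transpose-inverse β α)) (trans (cong (transpose β α) eq) (transpose-inverse β α))

-- X is the set of columns on the α-β-chain through v.  The chain enters a row by α and leaves it by β,
-- so it never reaches a row where α is free.
module Kempe {a b Δ : ℕ} (φ : PartialColouring {a} {b} {Δ}) (φ-proper : Proper φ)
             (v : Fin b) (α β : Fin Δ) (β-free : FreeAtCol φ v β) where
  open Proper φ-proper

  Linked : Fin b → Fin b → Set
  Linked j j′ = ∃ λ i → φ i j ≡ just α × φ i j′ ≡ just β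

  -- The second half of `Inv` gives every column but `v` a predecessor on the chain, so that the
  -- chain can also be followed backwards.
  Inv Closed : Subset b → Set
  Inv X = v ∈ X × (∀ {j′} → j′ ∈ X → j′ ≡ v ⊎ ∃ λ j → j ∈ X × Linked j j′)
  Closed X = ∀ {j j′} → j ∈ X → Linked j j′ → j′ ∈ X

  _≟ᶜ_ : (x y : Maybe (Fin Δ)) → Dec (x ≡ y)
  _≟ᶜ_ = ≡-dec _≟_

  linked? : ∀ j j′ → Dec (Linked j j′)
  linked? j j′ = any? λ i → (φ i j ≟ᶜ just α) ×-dec (φ i j′ ≟ᶜ just β)

  step : ∀ X → Inv X → Closed X ⊎ ∃ λ z → z ∉ X × Inv (X ∪ ⁅ z ⁆)
  step X (v∈X , pred) with any? (λ z → ¬? (z ∈? X) ×-dec any? (λ j → (j ∈? X) ×-dec linked? j z))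
  ... | no ¬p = inj₁ λ {j} {j′} j∈X l →
    decidable-stable (j′ ∈? X) λ j′∉X → ¬p (j′ , j′∉X , j , j∈X , l)
  ... | yes (z , z∉X , j , j∈X , l) = inj₂ (z , z∉X , p⊆p∪q _ v∈X , λ j′∈ → case x∈p∪q⁻ X ⁅ z ⁆ j′∈ of λ where
      (inj₁ j′∈X) → case pred j′∈X of λ where
        (inj₁ e)              → inj₁ e
        (inj₂ (k , k∈X , l′)) → inj₂ (k , p⊆p∪q _ k∈X , l′)
      (inj₂ j′∈z) → inj₂ (j , p⊆p∪q _ j∈X , subst (Linked j) (sym (x∈⁅y⁆⇒x≡y z j′∈z)) l))

  init : Inv ⁅ v ⁆
  init = x∈⁅x⁆ v , λ j′∈ → inj₁ (x∈⁅y⁆⇒x≡y v j′∈)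

  chain : ∃ λ X → Inv X × Closed X
  chain = grow Inv Closed step ⁅ v ⁆ init

  X : Subset b
  X = proj₁ chain
  v∈X : v ∈ X
  v∈X = proj₁ (proj₁ (proj₂ chain))
  closed : Closed X
  closed = proj₂ (proj₂ chain)

  -- Column `j` is not `v`, where β is free, so it has a predecessor; as column `j` has only one β,
  -- the link runs through row `i`.
  closed⁻ : ∀ {i j} → j ∈ X → φ i j ≡ just β → ∃ λ j′ → j′ ∈ X × φ i j′ ≡ just α
  closed⁻ {i} {j} j∈X p with proj₂ (proj₁ (proj₂ chain)) j∈X
  ... | inj₁ refl = ⊥-elim (β-free i p)
  ... | inj₂ (j′ , j′∈X , i′ , q , q′) with col p q′
  ... | refl = j′ , j′∈X , q

  exchange : Fin Δ → Fin Δ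
  exchange = transpose α β

  recoloured : PartialColouring
  recoloured i j with j ∈? X
  ... | yes _ = mapᴹ exchange (φ i j)
  ... | no  _ = φ i j

  recoloured⁻ : ∀ i j {k} → recoloured i j ≡ just k →
    (j ∈ X × ∃ λ l → φ i j ≡ just l × exchange l ≡ k) ⊎ (j ∉ X × φ i j ≡ just k)
  recoloured⁻ i j p with j ∈? X
  ... | no  j∉X = inj₂ (j∉X , p)
  ... | yes j∈X with φ i j
  ...   | just l = inj₁ (j∈X , l , refl , just-injective p)

  recoloured-nothing : ∀ i j → φ i j ≡ nothing → recoloured i j ≡ nothing
  recoloured-nothing i j p with j ∈? X
  ... | no  _ = p
  ... | yes _ rewrite p = refl

  recoloured-just : ∀ i j {k} → φ i j ≡ just k → ∃ λ l → recoloured i j ≡ just l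
  recoloured-just i j p with j ∈? X
  ... | no  _ = _ , p
  ... | yes _ rewrite p = _ , refl

  -- The only possible clash: one row, one column inside `X` and one outside. A new β is excluded by
  -- `closed`, a new α by `closed⁻`, any other colour by properness of `φ`.
  mixed : ∀ {i j j′ k l} → j ∈ X → φ i j ≡ just l → exchange l ≡ k → j′ ∉ X → φ i j′ ≡ just k → ⊥
  mixed {i} {j} {j′} {k} {l} j∈X p e j′∉X q with transpose-cases α β l
  ... | inj₁ (refl , e′) = j′∉X (closed j∈X (i , p , trans q (cong just (trans (sym e) e′))))
  ... | inj₂ (inj₂ (_ , e′)) = j′∉X (subst (_∈ X) (row p (trans q (cong just (trans (sym e) e′)))) j∈X)
  ... | inj₂ (inj₁ (refl , e′)) with closed⁻ j∈X p
  ...   | j″ , j″∈X , r = j′∉X (subst (_∈ X) (row r (trans q (cong just (trans (sym e) e′)))) j″∈X)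

  recoloured-proper : Proper recoloured
  recoloured-proper = record
    { row = λ {i} {j} {j′} → row′ {i} {j} {j′}
    ; col = λ {i} {i′} {j} → col′ {i} {i′} {j} }
    where
    row′ : ∀ {i j j′ k} → recoloured i j ≡ just k → recoloured i j′ ≡ just k → j ≡ j′
    row′ {i} {j} {j′} p q with recoloured⁻ i j p | recoloured⁻ i j′ q
    ... | inj₁ (_ , l , p′ , e)   | inj₁ (_ , l′ , q′ , e′) =
      row p′ (trans q′ (cong just (transpose-injective α β (trans e′ (sym e)))))
    ... | inj₁ (j∈X , l , p′ , e) | inj₂ (j′∉X , q′)         = ⊥-elim (mixed j∈X p′ e j′∉X q′)
    ... | inj₂ (j∉X , p′)         | inj₁ (j′∈X , l , q′ , e) = ⊥-elim (mixed j′∈X q′ e j∉X p′)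
    ... | inj₂ (_ , p′)           | inj₂ (_ , q′)            = row p′ q′
    col′ : ∀ {i i′ j k} → recoloured i j ≡ just k → recoloured i′ j ≡ just k → i ≡ i′
    col′ {i} {i′} {j} p q with recoloured⁻ i j p | recoloured⁻ i′ j q
    ... | inj₁ (_ , l , p′ , e) | inj₁ (_ , l′ , q′ , e′) =
      col p′ (trans q′ (cong just (transpose-injective α β (trans e′ (sym e)))))
    ... | inj₁ (j∈X , _)        | inj₂ (j∉X , _)          = ⊥-elim (j∉X j∈X)
    ... | inj₂ (j∉X , _)        | inj₁ (j∈X , _)          = ⊥-elim (j∉X j∈X)
    ... | inj₂ (_ , p′)         | inj₂ (_ , q′)           = col p′ q′

  α-free-at-v : FreeAtCol recoloured v α
  α-free-at-v i p with recoloured⁻ i v p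
  ... | inj₂ (v∉X , _) = v∉X v∈X
  ... | inj₁ (_ , l , q , e) with transpose-cases α β l
  ...   | inj₁ (refl , e′)       = β-free i (trans q (cong just (trans (sym e) e′)))
  ...   | inj₂ (inj₁ (refl , _)) = β-free i q
  ...   | inj₂ (inj₂ (l≢α , e′)) = l≢α (trans (sym e′) e)

  -- A new α in row `u` replaces a β on the chain, and by `closed⁻` such a row already had an α.
  α-free-stays : ∀ u → FreeAtRow φ u α → FreeAtRow recoloured u α
  α-free-stays u α-free j p with recoloured⁻ u j p
  ... | inj₂ (_ , q) = α-free j q
  ... | inj₁ (j∈X , l , q , e) with transpose-cases α β l
  ...   | inj₁ (refl , _)        = α-free j q
  ...   | inj₂ (inj₂ (_ , e′))   = α-free j (trans q (cong just (trans (sym e′) e)))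
  ...   | inj₂ (inj₁ (refl , _)) with closed⁻ j∈X q
  ...     | j′ , _ , r = α-free j′ r

-- A cardinality bound phrased as the absence of `suc Δ` distinct members, which needs no counting
-- function for `P`.
AtMost : ∀ {b} → ℕ → (Fin b → Set) → Set
AtMost {b} Δ P = ∀ (h : Fin (suc Δ) → Fin b) → Inj h → (∀ k → P (h k)) → ⊥

-- If all `Δ` colours occurred, their positions together with the uncoloured `v` would be `suc Δ`
-- members of `P`.
free-colour : ∀ {b Δ} {P : Fin b → Set} → AtMost Δ P → (ψ : Fin b → Maybe (Fin Δ)) →
  (∀ {j k} → ψ j ≡ just k → P j) → ∀ v → P v → ψ v ≡ nothing → ∃ λ k → ∀ j → ψ j ≢ just k
free-colour {b} {Δ} {P} few ψ dom v Pv none with all? (λ k → any? λ j → ≡-dec _≟_ (ψ j) (just k))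
... | no ¬all = case ¬∀⟶∃¬ Δ _ (λ k → any? λ j → ≡-dec _≟_ (ψ j) (just k)) ¬all of λ
  { (k , ¬p) → k , λ j p → ¬p (j , p) }
... | yes all = ⊥-elim (few h h-inj h-P)
  where
  h : Fin (suc Δ) → Fin b
  h zero    = v
  h (suc k) = proj₁ (all k)
  h-P : ∀ k → P (h k)
  h-P zero    = Pv
  h-P (suc k) = dom (proj₂ (all k))
  h-inj : Inj h
  h-inj {zero}  {zero}  _  = refl
  h-inj {zero}  {suc y} eq = case trans (sym none) (trans (cong ψ eq) (proj₂ (all y))) of λ ()
  h-inj {suc x} {zero}  eq = case trans (sym none) (trans (cong ψ (sym eq)) (proj₂ (all x))) of λ ()
  h-inj {suc x} {suc y} eq =
    cong suc (just-injective (trans (sym (proj₂ (all x))) (trans (cong ψ eq) (proj₂ (all y)))))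

konig : ∀ {a b} Δ (G : Fin a → Fin b → Set) → (∀ i j → Dec (G i j)) →
  (∀ i → AtMost Δ (G i)) → (∀ j → AtMost Δ (λ i → G i j)) →
  ∃ λ (φ : PartialColouring {a} {b} {Δ}) → Proper φ × (∀ i j → G i j → ∃ λ k → φ i j ≡ just k)
konig {a} {b} Δ G G? rows cols =
  case sweep² Done extend ((λ _ _ → nothing) , record { row = λ () ; col = λ () } , λ ()) of λ
    { ((φ , φ-proper , _) , done) → φ , φ-proper , done }
  where
  State : Set
  State = Σ PartialColouring λ φ → Proper φ × (∀ {i j k} → φ i j ≡ just k → G i j)

  Done : State → Fin a → Fin b → Set
  Done (φ , _) i j = G i j → ∃ λ k → φ i j ≡ just k

  extend : ∀ s u v → ∃ λ s′ → Done s′ u v × (∀ i j → Done s i j → Done s′ i j)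
  extend s@(φ , φ-proper , dom) u v with G? u v | φ u v in φuv
  ... | no ¬g | _      = s , (λ g → ⊥-elim (¬g g)) , λ _ _ d → d
  ... | yes _ | just k = s , (λ _ → k , φuv) , λ _ _ d → d
  -- The degree bounds leave some α free at row `u` and some β free at column `v`. Exchanging along
  -- the chain through `v` makes α free at both.
  ... | yes g | nothing
    with free-colour (rows u) (φ u) dom v g φuv | free-colour (cols v) (λ i → φ i v) dom u g φuv
  ...   | α , α-free | β , β-free =
    (ψ , assign-proper recoloured-proper (α-free-stays u α-free) α-free-at-v , λ {i} {j} → ψ-dom {i} {j}) ,
    (λ _ → α , assign-here recoloured u v α) , λ i j d g′ → ψ-keeps {i} {j} (d g′)
    where
    open Kempe φ φ-proper v α β β-free
    ψ : PartialColouring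
    ψ = assign recoloured u v α
    ψ-dom : ∀ {i j k} → ψ i j ≡ just k → G i j
    ψ-dom {i} {j} p with assign⁻ recoloured u v α i j p
    ... | inj₁ (refl , refl , _) = g
    ... | inj₂ q with recoloured⁻ i j q
    ...   | inj₁ (_ , _ , r , _) = dom r
    ...   | inj₂ (_ , r)         = dom r
    ψ-keeps : ∀ {i j} → (∃ λ k → φ i j ≡ just k) → ∃ λ k → ψ i j ≡ just k
    ψ-keeps {i} {j} (k , p) with recoloured-just i j p
    ... | l , q = l , assign-keeps recoloured u v α {i} {j} (recoloured-nothing u v φuv) q

-- Completing Latin rectangles

preimage : ∀ {m n} → (Fin m → Fin n) → Fin n → Maybe (Fin m)
preimage f y with any? (λ i → f i ≟ y)
... | yes (i , _) = just i
... | no  _       = nothing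

preimage-just : ∀ {m n} (f : Fin m → Fin n) {y i} → preimage f y ≡ just i → f i ≡ y
preimage-just f {y} p with any? (λ i → f i ≟ y)
preimage-just f refl | yes (i , e) = e

preimage-nothing : ∀ {m n} (f : Fin m → Fin n) {y} → preimage f y ≡ nothing → ∀ i → f i ≢ y
preimage-nothing f {y} p with any? (λ i → f i ≟ y)
... | no ¬e = λ i e → ¬e (i , e)

preimage-image : ∀ {m n} (f : Fin m → Fin n) → Inj f → ∀ i → preimage f (f i) ≡ just i
preimage-image f f-inj i with any? (λ j → f j ≟ f i)
... | yes (j , e) = cong just (f-inj e)
... | no ¬e       = ⊥-elim (¬e (i , refl))

-- `P` avoids the `m` values of `f`, which leaves at most `k` places.
disjoint⇒AtMost : ∀ {m n k} (P : Fin n → Set) (f : Fin m → Fin n) → Inj f → (∀ i → ¬ P (f i)) →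
                  n ≤ k + m → AtMost k P
disjoint⇒AtMost {m} {n} {k} P f f-inj ¬P n≤k+m h h-inj hP =
  contradiction (≤-trans (⊎-injective⇒≤ g g-inj) n≤k+m) 1+n≰n
  where
  g : Fin (suc k) ⊎ Fin m → Fin n
  g (inj₁ x) = h x
  g (inj₂ y) = f y
  g-inj : Inj g
  g-inj {inj₁ x} {inj₁ y} e = cong inj₁ (h-inj e)
  g-inj {inj₁ x} {inj₂ y} e = ⊥-elim (¬P y (subst P e (hP x)))
  g-inj {inj₂ x} {inj₁ y} e = ⊥-elim (¬P x (subst P (sym e) (hP y)))
  g-inj {inj₂ x} {inj₂ y} e = cong inj₂ (f-inj e)

-- The uncoloured cells form a bipartite graph of maximum degree at most `d`; König's theorem
-- colours it, and the disjoint sum keeps the new colours apart from the old.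
extend-colouring : ∀ {a b s d} (p : PartialColouring {a} {b} {s}) → Proper p →
  (∀ i → AtMost d (λ x → p i x ≡ nothing)) → (∀ x → AtMost d (λ i → p i x ≡ nothing)) →
  ∃ λ (q : Fin a → Fin b → Fin s ⊎ Fin d) →
    (∀ i → Inj (q i)) × (∀ x → Inj (λ i → q i x)) × (∀ {i x j} → p i x ≡ just j → q i x ≡ inj₁ j)
extend-colouring {a} {b} {s} {d} p p-proper rows cols
  with konig d (λ i x → p i x ≡ nothing) (λ i x → ≡-dec _≟_ (p i x) nothing) rows cols
... | φ , φ-proper , total = q , q-row , q-col , q-keeps
  where
  module P = Proper p-proper
  module Φ = Proper φ-proper
  value : ∀ i x (m : Maybe (Fin s)) → p i x ≡ m → Fin s ⊎ Fin d
  value i x (just j) _ = inj₁ j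
  value i x nothing  e = inj₂ (proj₁ (total i x e))
  q : Fin a → Fin b → Fin s ⊎ Fin d
  q i x = value i x (p i x) refl
  spec : ∀ i x → (∃ λ j → p i x ≡ just j × q i x ≡ inj₁ j) ⊎ (∃ λ k → φ i x ≡ just k × q i x ≡ inj₂ k)
  spec i x = go (p i x) refl
    where
    go : ∀ m (e : p i x ≡ m) →
         (∃ λ j → p i x ≡ just j × value i x m e ≡ inj₁ j) ⊎ (∃ λ k → φ i x ≡ just k × value i x m e ≡ inj₂ k)
    go (just j) e = inj₁ (j , e , refl)
    go nothing  e = inj₂ (proj₁ (total i x e) , proj₂ (total i x e) , refl)
  q-row : ∀ i → Inj (q i)
  q-row i {x} {y} e with spec i x | spec i y
  ... | inj₁ (j , u , u′) | inj₁ (k , v , v′) =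
    P.row u (trans v (cong just (inj₁-injective (trans (sym v′) (trans (sym e) u′)))))
  ... | inj₂ (j , u , u′) | inj₂ (k , v , v′) =
    Φ.row u (trans v (cong just (inj₂-injective (trans (sym v′) (trans (sym e) u′)))))
  ... | inj₁ (j , u , u′) | inj₂ (k , v , v′) = case trans (sym u′) (trans e v′) of λ ()
  ... | inj₂ (j , u , u′) | inj₁ (k , v , v′) = case trans (sym u′) (trans e v′) of λ ()
  q-col : ∀ x → Inj (λ i → q i x)
  q-col x {i} {i′} e with spec i x | spec i′ x
  ... | inj₁ (j , u , u′) | inj₁ (k , v , v′) =
    P.col u (trans v (cong just (inj₁-injective (trans (sym v′) (trans (sym e) u′)))))
  ... | inj₂ (j , u , u′) | inj₂ (k , v , v′) =
    Φ.col u (trans v (cong just (inj₂-injective (trans (sym v′) (trans (sym e) u′)))))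
  ... | inj₁ (j , u , u′) | inj₂ (k , v , v′) = case trans (sym u′) (trans e v′) of λ ()
  ... | inj₂ (j , u , u′) | inj₁ (k , v , v′) = case trans (sym u′) (trans e v′) of λ ()
  q-keeps : ∀ {i x j} → p i x ≡ just j → q i x ≡ inj₁ j
  q-keeps {i} {x} = go (p i x) refl
    where
    go : ∀ m (e : p i x ≡ m) {j} → m ≡ just j → value i x m e ≡ inj₁ j
    go _ _ refl = refl

-- `C i x` is the column in which row `i` holds symbol `x`. Rows thus colour pairs of a column and a
-- symbol; each column lacks `n - r` symbols and each symbol `n - r` columns, and the new colours
-- are the missing rows.
latin-rectangle-completes : ∀ {r e n} (C : Fin r → Fin n → Fin n) →
  (∀ i → Inj (C i)) → (∀ x → Inj (λ i → C i x)) → n ≤ e + r →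
  ∃ λ (R : Fin n → Fin n → Fin r ⊎ Fin e) →
    (∀ v → Inj (R v)) × (∀ x → Inj (λ v → R v x)) × (∀ i x → R (C i x) x ≡ inj₁ i)
latin-rectangle-completes {r} {e} {n} C C-row C-col n≤e+r =
  case extend-colouring {d = e} p p-proper p-row p-col of λ
    { (R , R-row , R-col , R-keeps) →
        R , R-row , R-col , λ i x → R-keeps (preimage-image (λ i′ → C i′ x) (C-col x) i) }
  where
  p : PartialColouring
  p v x = preimage (λ i → C i x) v
  p-just : ∀ v x {i} → p v x ≡ just i → C i x ≡ v
  p-just v x = preimage-just (λ i → C i x)
  p-proper : Proper p
  p-proper = record
    { row = λ {v} {x} {y} {i} u w → C-row i (trans (p-just v x u) (sym (p-just v y w)))
    ; col = λ {v} {v′} {x} u w → trans (sym (p-just v x u)) (p-just v′ x w) }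
  symbol : ∀ v i → ∃ λ x → C i x ≡ v
  symbol v i = injective⇒surjective (C i) (C-row i) v
  symbol-inj : ∀ v → Inj (λ i → proj₁ (symbol v i))
  symbol-inj v {i} {i′} eq = C-col (proj₁ (symbol v i))
    (trans (proj₂ (symbol v i)) (trans (sym (proj₂ (symbol v i′))) (cong (C i′) (sym eq))))
  p-row : ∀ v → AtMost e (λ x → p v x ≡ nothing)
  p-row v = disjoint⇒AtMost (λ x → p v x ≡ nothing) (λ i → proj₁ (symbol v i)) (symbol-inj v)
    (λ i none → preimage-nothing (λ i′ → C i′ (proj₁ (symbol v i))) none i (proj₂ (symbol v i))) n≤e+r
  p-col : ∀ x → AtMost e (λ v → p v x ≡ nothing)
  p-col x = disjoint⇒AtMost (λ v → p v x ≡ nothing) (λ i → C i x) (C-col x)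
    (λ i none → preimage-nothing (λ i′ → C i′ x) none i refl) n≤e+r

-- For an r × s block with r + s = n + 1, Ryser's condition is that every symbol occurs.
block-widens : ∀ {d e} (let n = suc (d + e)) (Q : Fin (suc d) → Fin (suc e) → Fin n) →
  (∀ i → Inj (Q i)) → (∀ j → Inj (λ i → Q i j)) → (∀ x → ∃ λ i → ∃ λ j → Q i j ≡ x) →
  ∃ λ (C : Fin (suc d) → Fin n → Fin (suc e) ⊎ Fin d) →
    (∀ i → Inj (C i)) × (∀ x → Inj (λ i → C i x)) × (∀ i j → C i (Q i j) ≡ inj₁ j)
block-widens {d} {e} Q Q-row Q-col Q-onto =
  case extend-colouring {d = d} p p-proper p-row p-col of λ
    { (C , C-row , C-col , C-keeps) →
        C , C-row , C-col , λ i j → C-keeps (preimage-image (Q i) (Q-row i) j) }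
  where
  -- Here columns colour pairs of a row and a symbol. A row of the block lacks `n - suc e = d`
  -- symbols.
  p : PartialColouring
  p i = preimage (Q i)
  p-proper : Proper p
  p-proper = record
    { row = λ {i} u w → trans (sym (preimage-just (Q i) u)) (preimage-just (Q i) w)
    ; col = λ {i} {i′} {x} {j} u w → Q-col j (trans (preimage-just (Q i) u) (sym (preimage-just (Q i′) w))) }
  p-row : ∀ i → AtMost d (λ x → p i x ≡ nothing)
  p-row i = disjoint⇒AtMost (λ x → p i x ≡ nothing) (Q i) (Q-row i)
    (λ j none → preimage-nothing (Q i) none j refl) (≤-reflexive (sym (+-suc d e)))
  -- If `suc d` rows lacked `x`, these would be all rows of the block, yet `x` occurs in one.
  p-col : ∀ x → AtMost d (λ i → p i x ≡ nothing)
  p-col x h h-inj none with Q-onto x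
  ... | i , j , Qij≡x with injective⇒surjective h h-inj i
  ...   | k , refl = preimage-nothing (Q (h k)) (none k) j Qij≡x

-- The Latin square is read as a map from column and symbol to row, the form the second colouring
-- yields. `rows` and `cols` put the block on its own lines of the square.
ryser : ∀ {d e} (let n = suc (d + e)) (Q : Fin (suc d) → Fin (suc e) → Fin n) →
  (∀ i → Inj (Q i)) → (∀ j → Inj (λ i → Q i j)) → (∀ x → ∃ λ i → ∃ λ j → Q i j ≡ x) →
  (rows : Fin (suc d) ⊎ Fin e → Fin n) → Inj rows → (cols : Fin (suc e) ⊎ Fin d → Fin n) → Inj cols →
  ∃ λ (R : Fin n → Fin n → Fin n) →
    (∀ v → Inj (R v)) × (∀ x → Inj (λ v → R v x)) × (∀ i j → R (cols (inj₁ j)) (Q i j) ≡ rows (inj₁ i))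
ryser {d} {e} Q Q-row Q-col Q-onto rows rows-inj cols cols-inj =
  case block-widens Q Q-row Q-col Q-onto of λ { (C , C-row , C-col , C-keeps) →
  case latin-rectangle-completes {e = e} (λ i x → cols (C i x)) (λ i {_} {_} eq → C-row i (cols-inj eq))
         (λ x {_} {_} eq → C-col x (cols-inj eq)) (≤-reflexive (+-comm (suc d) e)) of λ { (R , R-row , R-col , R-keeps) →
  (λ v x → rows (R v x)) , (λ v {_} {_} eq → R-row v (rows-inj eq)) , (λ x {_} {_} eq → R-col x (rows-inj eq)) ,
  λ i j → cong rows (trans (cong (λ c → R (cols c) (Q i j)) (sym (C-keeps i j))) (R-keeps i (Q i j))) } }

-- Greedy filling of the block

free-symbol : ∀ {r s n} (φ : PartialColouring {r} {s} {n}) → r + s ≤ suc n → ∀ u v → φ u v ≡ nothing →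
  ∃ λ k → FreeAtRow φ u k × FreeAtCol φ v k
free-symbol {r} {s} {n} φ r+s≤1+n u v none = case all? used? of λ where
    (no ¬all) → case ¬∀⟶∃¬ n Used used? ¬all of λ
      { (k , ¬p) → k , (λ j p → ¬p (inj₁ (j , p))) , λ i p → ¬p (inj₂ (i , p)) }
    (yes all) → contradiction (≤-trans (injective⇒≤-⊎ (line all) (line-inj all)) r+s≤1+n) 1+n≰n
  where
  Used : Fin n → Set
  Used k = (∃ λ j → φ u j ≡ just k) ⊎ (∃ λ i → φ i v ≡ just k)
  used? : ∀ k → Dec (Used k)
  used? k = any? (λ j → ≡-dec _≟_ (φ u j) (just k)) ⊎-dec any? (λ i → ≡-dec _≟_ (φ i v) (just k))
  module _ (all : ∀ k → Used k) where
    -- The lines through the cell (u , v) are the two values of `line` that no symbol can take.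
    line : Fin (suc (suc n)) → Fin r ⊎ Fin s
    line zero          = inj₁ u
    line (suc zero)    = inj₂ v
    line (suc (suc k)) = case all k of λ { (inj₁ (j , _)) → inj₂ j ; (inj₂ (i , _)) → inj₁ i }
    spec : ∀ k → (∃ λ j → φ u j ≡ just k × line (suc (suc k)) ≡ inj₂ j) ⊎
                 (∃ λ i → φ i v ≡ just k × line (suc (suc k)) ≡ inj₁ i)
    spec k with all k
    ... | inj₁ (j , p) = inj₁ (j , p , refl)
    ... | inj₂ (i , p) = inj₂ (i , p , refl)
    ≢u : ∀ k → line (suc (suc k)) ≢ inj₁ u
    ≢u k e with spec k
    ... | inj₁ (j , p , q) = case trans (sym q) e of λ ()
    ... | inj₂ (i , p , q) with trans (sym q) e
    ...   | refl = case trans (sym none) p of λ ()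
    ≢v : ∀ k → line (suc (suc k)) ≢ inj₂ v
    ≢v k e with spec k
    ... | inj₂ (j , p , q) = case trans (sym q) e of λ ()
    ... | inj₁ (i , p , q) with trans (sym q) e
    ...   | refl = case trans (sym none) p of λ ()
    line-inj : Inj line
    line-inj {zero}        {zero}        e  = refl
    line-inj {zero}        {suc (suc k)} e  = ⊥-elim (≢u k (sym e))
    line-inj {suc zero}    {suc zero}    e  = refl
    line-inj {suc zero}    {suc (suc k)} e  = ⊥-elim (≢v k (sym e))
    line-inj {suc (suc k)} {zero}        e  = ⊥-elim (≢u k e)
    line-inj {suc (suc k)} {suc zero}    e  = ⊥-elim (≢v k e)
    line-inj {suc (suc k)} {suc (suc l)} e with spec k | spec l
    ... | inj₁ (j , p , q) | inj₁ (j′ , p′ , q′) with trans (sym q) (trans e q′)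
    ...   | refl = cong (λ x → suc (suc x)) (just-injective (trans (sym p) p′))
    line-inj {suc (suc k)} {suc (suc l)} e | inj₂ (i , p , q) | inj₂ (i′ , p′ , q′) with trans (sym q) (trans e q′)
    ...   | refl = cong (λ x → suc (suc x)) (just-injective (trans (sym p) p′))
    line-inj {suc (suc k)} {suc (suc l)} e | inj₁ (_ , _ , q) | inj₂ (_ , _ , q′) = case trans (sym q) (trans e q′) of λ ()
    line-inj {suc (suc k)} {suc (suc l)} e | inj₂ (_ , _ , q) | inj₁ (_ , _ , q′) = case trans (sym q) (trans e q′) of λ ()

fill : ∀ {r s n} (φ : PartialColouring {r} {s} {n}) → Proper φ → r + s ≤ suc n →
  ∃ λ (Q : Fin r → Fin s → Fin n) →
    (∀ i → Inj (Q i)) × (∀ j → Inj (λ i → Q i j)) × (∀ {i j k} → φ i j ≡ just k → Q i j ≡ k)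
fill {r} {s} {n} φ φ-proper r+s≤1+n with sweep² Done step (φ , φ-proper , λ p → p)
  where
  State : Set
  State = Σ PartialColouring λ ψ → Proper ψ × (∀ {i j k} → φ i j ≡ just k → ψ i j ≡ just k)
  Done : State → Fin r → Fin s → Set
  Done (ψ , _) i j = ∃ λ k → ψ i j ≡ just k
  step : ∀ t u v → ∃ λ t′ → Done t′ u v × (∀ i j → Done t i j → Done t′ i j)
  step t@(ψ , ψ-proper , ext) u v with ψ u v in ψuv
  ... | just k  = t , (k , ψuv) , λ _ _ d → d
  ... | nothing with free-symbol ψ r+s≤1+n u v ψuv
  ...   | k , free-u , free-v =
    (assign ψ u v k , assign-proper ψ-proper free-u free-v , λ {i} {j} p → assign-keeps ψ u v k {i} {j} ψuv (ext p)) ,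
    (k , assign-here ψ u v k) , λ { i j (l , p) → l , assign-keeps ψ u v k {i} {j} ψuv p }
... | (ψ , ψ-proper , ext) , done =
  (λ i j → proj₁ (done i j)) ,
  (λ i {j} {j′} e → row (proj₂ (done i j)) (trans (proj₂ (done i j′)) (cong just (sym e)))) ,
  (λ j {i} {i′} e → col (proj₂ (done i j)) (trans (proj₂ (done i′ j)) (cong just (sym e)))) ,
  λ {i} {j} p → just-injective (trans (sym (proj₂ (done i j))) (ext p))
  where open Proper ψ-proper

-- Pairing the cells of the two colours

transpose-snd : ∀ {n} (x z : Fin n) → transpose x z z ≡ x
transpose-snd x z with z ≟ x
... | yes z≡x = z≡x
... | no  _ with z ≟ z
...   | yes _ = refl
...   | no ¬p = ⊥-elim (¬p refl)

transpose-other : ∀ {n} (x z : Fin n) {w} → w ≢ x → w ≢ z → transpose x z w ≡ w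
transpose-other x z {w} w≢x w≢z with w ≟ x
... | yes w≡x = ⊥-elim (w≢x w≡x)
... | no  _ with w ≟ z
...   | yes w≡z = ⊥-elim (w≢z w≡z)
...   | no  _   = refl

-- Hall's theorem by alternating paths. The matching is carried by an injection `g` on all of
-- `Fin n`; `x` counts as matched when `Rel x (g x)` holds.
module Augment {n : ℕ} (Rel : Fin n → Fin n → Set) (rel? : ∀ x y → Dec (Rel x y)) where

  -- A violation of Hall's condition: all partners of `X` are values of `g` on `X` without `x₀`, one
  -- too few.
  record Obstruction (g : Fin n → Fin n) (x₀ : Fin n) : Set where
    field
      X       : Subset n
      x₀∈X    : x₀ ∈ X
      ¬rel-x₀ : ∀ {x} → x ∈ X → ¬ Rel x (g x₀)
      ¬rel    : ∀ {x z} → x ∈ X → z ∉ X → ¬ Rel x (g z)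

  module _ (g : Fin n → Fin n) (g-inj : Inj g) (x₀ : Fin n) where

    -- h arises from g by moving the value g x₀ along an alternating path to x.
    record Rerouted (X : Subset n) (x : Fin n) : Set where
      field
        h      : Fin n → Fin n
        h-inj  : Inj h
        h-x    : h x ≡ g x₀
        h-rel  : ∀ {z} → z ≢ x → Rel z (g z) ⊎ z ≡ x₀ → Rel z (h z)
        h-off  : ∀ {z} → z ∉ X → h z ≡ g z

    -- Growth stops at an end of an augmenting path or at an obstruction.
    Inv Closed : Subset n → Set
    Inv X    = x₀ ∈ X × (∀ {x} → x ∈ X → Rerouted X x)
    Closed X = (∃ λ x → x ∈ X × Rel x (g x₀)) ⊎
               ((∀ {x} → x ∈ X → ¬ Rel x (g x₀)) × (∀ {x z} → x ∈ X → z ∉ X → ¬ Rel x (g z)))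

    init : Inv ⁅ x₀ ⁆
    init = x∈⁅x⁆ x₀ , λ x∈ → record
      { h     = g
      ; h-inj = g-inj
      ; h-x   = cong g (x∈⁅y⁆⇒x≡y x₀ x∈)
      ; h-rel = λ { z≢x (inj₁ r) → r ; z≢x (inj₂ z≡x₀) → ⊥-elim (z≢x (trans z≡x₀ (sym (x∈⁅y⁆⇒x≡y x₀ x∈)))) }
      ; h-off = λ _ → refl
      }

    weaken : ∀ {X x} z → Rerouted X x → Rerouted (X ∪ ⁅ z ⁆) x
    weaken z R = record
      { h = h ; h-inj = h-inj ; h-x = h-x ; h-rel = h-rel ; h-off = λ w∉ → h-off λ w∈X → w∉ (p⊆p∪q ⁅ z ⁆ w∈X) }
      where open Rerouted R

    -- The path is prolonged by a swap: `x` takes `g z`, untouched so far by `h-off`, and `z` takes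
    -- over the value `g x₀`.
    advance : ∀ {X x z} → x ∈ X → z ∉ X → Rel x (g z) → Rerouted X x → Rerouted (X ∪ ⁅ z ⁆) z
    advance {X} {x} {z} x∈X z∉X r R = record
      { h     = h ∘ transpose x z
      ; h-inj = λ eq → transpose-injective x z (h-inj eq)
      ; h-x   = trans (cong h (transpose-snd x z)) h-x
      ; h-rel = h-rel′
      ; h-off = λ w∉ → trans
          (cong h (transpose-other x z (λ { refl → w∉ (p⊆p∪q ⁅ z ⁆ x∈X) }) (λ { refl → w∉ (q⊆p∪q X ⁅ z ⁆ (x∈⁅x⁆ z)) })))
          (h-off λ w∈X → w∉ (p⊆p∪q ⁅ z ⁆ w∈X))
      }
      where
      open Rerouted R
      h-rel′ : ∀ {w} → w ≢ z → Rel w (g w) ⊎ w ≡ x₀ → Rel w (h (transpose x z w))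
      h-rel′ {w} w≢z q with w ≟ x
      ... | yes refl = subst (Rel x) (sym (h-off z∉X)) r
      ... | no  w≢x  with w ≟ z
      ...   | yes w≡z = ⊥-elim (w≢z w≡z)
      ...   | no  _   = h-rel w≢x q

    step : ∀ X → Inv X → Closed X ⊎ ∃ λ z → z ∉ X × Inv (X ∪ ⁅ z ⁆)
    step X (x₀∈X , re) with any? (λ x → (x ∈? X) ×-dec rel? x (g x₀))
    ... | yes found = inj₁ (inj₁ found)
    ... | no ¬found with any? (λ z → ¬? (z ∈? X) ×-dec any? (λ x → (x ∈? X) ×-dec rel? x (g z)))
    ...   | no ¬p = inj₁ (inj₂ ((λ x∈X r → ¬found (_ , x∈X , r)) , λ x∈X z∉X r → ¬p (_ , z∉X , _ , x∈X , r)))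
    ...   | yes (z , z∉X , x , x∈X , r) = inj₂ (z , z∉X , p⊆p∪q ⁅ z ⁆ x₀∈X , re′)
      where
      re′ : ∀ {w} → w ∈ X ∪ ⁅ z ⁆ → Rerouted (X ∪ ⁅ z ⁆) w
      re′ w∈ with x∈p∪q⁻ X ⁅ z ⁆ w∈
      ... | inj₁ w∈X = weaken z (re w∈X)
      ... | inj₂ w∈z = subst (Rerouted _) (sym (x∈⁅y⁆⇒x≡y z w∈z)) (advance x∈X z∉X r (re x∈X))

    augment : ¬ Obstruction g x₀ →
      ∃ λ (h : Fin n → Fin n) → Inj h × Rel x₀ (h x₀) × (∀ z → Rel z (g z) → Rel z (h z))
    augment ¬obs with grow Inv Closed step ⁅ x₀ ⁆ init
    ... | X , (x₀∈X , _) , inj₂ (¬r , ¬r′) =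
      ⊥-elim (¬obs (record { X = X ; x₀∈X = x₀∈X ; ¬rel-x₀ = ¬r ; ¬rel = ¬r′ }))
    ... | X , (_ , re) , inj₁ (x , x∈X , r) = h , (λ {_} {_} → h-inj) , rel (inj₂ refl) , λ z q → rel (inj₁ q)
      where
      open Rerouted (re x∈X)
      rel : ∀ {z} → Rel z (g z) ⊎ z ≡ x₀ → Rel z (h z)
      rel {z} q with z ≟ x
      ... | yes refl = subst (Rel z) (sym h-x) r
      ... | no  z≢x  = h-rel z≢x q

  perfect-matching : (∀ g → Inj g → ∀ x₀ → ¬ Obstruction g x₀) →
    ∃ λ (g : Fin n → Fin n) → Inj g × (∀ x → Rel x (g x))
  perfect-matching ¬obs = case sweep Done improve (allFin n) ((λ x → x) , λ eq → eq) of λ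
    { ((g , g-inj) , done , _) → g , (λ {_} {_} → g-inj) , λ x → done (∈-allFin x) }
    where
    Done : (Σ (Fin n → Fin n) Inj) → Fin n → Set
    Done (g , _) x = Rel x (g x)
    improve : ∀ s x → ∃ λ s′ → Done s′ x × (∀ z → Done s z → Done s′ z)
    improve (g , g-inj) x = case augment g g-inj x (¬obs g g-inj x) of λ
      { (h , h-inj , done , keep) → (h , λ {_} {_} → h-inj) , done , keep }

Apart Meet : ∀ {r s} → Fin r × Fin s → Fin r × Fin s → Set
Apart c c′ = proj₁ c ≢ proj₁ c′ × proj₂ c ≢ proj₂ c′
Meet  c c′ = proj₁ c ≡ proj₁ c′ ⊎ proj₂ c ≡ proj₂ c′

¬apart⇒meet : ∀ {r s} (c c′ : Fin r × Fin s) → ¬ Apart c c′ → Meet c c′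
¬apart⇒meet (i , j) (i′ , j′) ¬ap with i ≟ i′ | j ≟ j′
... | yes p | _     = inj₁ p
... | no _  | yes q = inj₂ q
... | no p  | no q  = ⊥-elim (¬ap (p , q))

-- Two classes of cells that meet completely lie on one line or form a 2 × 2 square;
-- either way they have fewer than r + s cells.
module CompletelyMeeting {m r s : ℕ} (c : Fin m → Fin r × Fin s) (c-inj : Inj c) (side : Fin m → Bool)
  (meet : ∀ {p q} → side p ≡ true → side q ≡ false → Meet (c p) (c q)) (4<m : 4 < m) (r+s≤m : r + s ≤ m)
  where

  -- With `p₀` at `(ρ , x)` and `q₀` at `(ρ , y)`, cells off row `ρ` are confined to column `y` on
  -- the true side and to column `x` on the false side.
  module SameRow {p₀ q₀} (p₀-side : side p₀ ≡ true) (q₀-side : side q₀ ≡ false)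
                 (same : proj₁ (c p₀) ≡ proj₁ (c q₀)) where
    ρ = proj₁ (c p₀)
    x = proj₂ (c p₀)
    y = proj₂ (c q₀)

    x≢y : x ≢ y
    x≢y x≡y with c-inj (cong₂ _,_ same x≡y)
    ... | refl = case trans (sym p₀-side) q₀-side of λ ()

    off-true : ∀ {p} → side p ≡ true → proj₁ (c p) ≢ ρ → proj₂ (c p) ≡ y
    off-true sp p∉ρ with meet sp q₀-side
    ... | inj₁ e = ⊥-elim (p∉ρ (trans e (sym same)))
    ... | inj₂ e = e

    off-false : ∀ {q} → side q ≡ false → proj₁ (c q) ≢ ρ → proj₂ (c q) ≡ x
    off-false sq q∉ρ with meet p₀-side sq
    ... | inj₁ e = ⊥-elim (q∉ρ (sym e))
    ... | inj₂ e = sym e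

    -- The four cells are the corners of a square, each side holding a diagonal. A further cell
    -- would have to meet both ends of the opposite diagonal, hence be a corner; but there are more
    -- than four cells.
    square : ∀ {p q} → side p ≡ true → side q ≡ false → proj₁ (c p) ≢ ρ → proj₁ (c q) ≢ ρ →
             proj₁ (c p) ≡ proj₁ (c q) → ⊥
    square {p} {q} sp sq p∉ρ q∉ρ pq = <⇒≱ 4<m (injective⇒≤ {f = λ w → proj₁ (which w)} λ {w} {w′} eq →
        trans (proj₂ (which w)) (trans (cong corner eq) (sym (proj₂ (which w′)))))
      where
      corner : Fin 4 → Fin m
      corner 0F = p₀
      corner 1F = p
      corner 2F = q₀
      corner 3F = q
      which : ∀ w → ∃ λ k → w ≡ corner k
      which w with side w in sw
      ... | true with meet sw q₀-side | meet sw sq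
      ...   | inj₁ e | inj₁ e′ = ⊥-elim (q∉ρ (trans (sym e′) (trans e (sym same))))
      ...   | inj₁ e | inj₂ e′ = 0F , c-inj (cong₂ _,_ (trans e (sym same)) (trans e′ (off-false sq q∉ρ)))
      ...   | inj₂ e | inj₁ e′ = 1F , c-inj (cong₂ _,_ (trans e′ (sym pq)) (trans e (sym (off-true sp p∉ρ))))
      ...   | inj₂ e | inj₂ e′ = ⊥-elim (x≢y (trans (sym (off-false sq q∉ρ)) (trans (sym e′) e)))
      which w | false with meet p₀-side sw | meet sp sw
      ...   | inj₁ e | inj₁ e′ = ⊥-elim (p∉ρ (trans e′ (sym e)))
      ...   | inj₁ e | inj₂ e′ = 2F , c-inj (cong₂ _,_ (trans (sym e) same) (trans (sym e′) (off-true sp p∉ρ)))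
      ...   | inj₂ e | inj₁ e′ = 3F , c-inj (cong₂ _,_ (trans (sym e′) pq) (trans (sym e) (sym (off-false sq q∉ρ))))
      ...   | inj₂ e | inj₂ e′ = ⊥-elim (x≢y (trans e (trans (sym e′) (off-true sp p∉ρ))))

    -- Cells on `ρ` go to their column, the others to their row. Two cells off `ρ` with the same row
    -- lie on the same side, by `square`, hence in the same column. The line `ρ` itself is never
    -- taken, so `m < r + s`.
    line : Fin m → Fin r ⊎ Fin s
    line p with proj₁ (c p) ≟ ρ
    ... | yes _ = inj₂ (proj₂ (c p))
    ... | no  _ = inj₁ (proj₁ (c p))

    line≢ρ : ∀ p → line p ≢ inj₁ ρ
    line≢ρ p e with proj₁ (c p) ≟ ρ
    ... | no p∉ρ = p∉ρ (inj₁-injective e)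

    line-inj : Inj line
    line-inj {p} {q} e with proj₁ (c p) ≟ ρ | proj₁ (c q) ≟ ρ
    ... | yes p∈ρ | yes q∈ρ = c-inj (cong₂ _,_ (trans p∈ρ (sym q∈ρ)) (inj₂-injective e))
    ... | no p∉ρ  | no q∉ρ  with side p in sp | side q in sq
    ...   | true  | true  = c-inj (cong₂ _,_ (inj₁-injective e) (trans (off-true sp p∉ρ) (sym (off-true sq q∉ρ))))
    ...   | false | false = c-inj (cong₂ _,_ (inj₁-injective e) (trans (off-false sp p∉ρ) (sym (off-false sq q∉ρ))))
    ...   | true  | false = ⊥-elim (square sp sq p∉ρ q∉ρ (inj₁-injective e))
    ...   | false | true  = ⊥-elim (square sq sp q∉ρ p∉ρ (sym (inj₁-injective e)))

    impossible : ⊥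
    impossible = 1+n≰n (≤-trans (injective⇒≤-⊎ line⁺ line⁺-inj) r+s≤m)
      where
      line⁺ : Fin (suc m) → Fin r ⊎ Fin s
      line⁺ zero    = inj₁ ρ
      line⁺ (suc p) = line p
      line⁺-inj : Inj line⁺
      line⁺-inj {zero}  {zero}  _ = refl
      line⁺-inj {zero}  {suc q} e = ⊥-elim (line≢ρ q (sym e))
      line⁺-inj {suc p} {zero}  e = ⊥-elim (line≢ρ p e)
      line⁺-inj {suc p} {suc q} e = cong suc (line-inj e)

completely-meeting-small : ∀ {m r s} (c : Fin m → Fin r × Fin s) → Inj c → (side : Fin m → Bool) →
  (∀ {p q} → side p ≡ true → side q ≡ false → Meet (c p) (c q)) →
  ∀ {p q} → side p ≡ true → side q ≡ false → 4 < m → ¬ (r + s ≤ m)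
completely-meeting-small {m} {r} {s} c c-inj side meet sp sq 4<m r+s≤m with meet sp sq
... | inj₁ e = CompletelyMeeting.SameRow.impossible c c-inj side meet 4<m r+s≤m sp sq e
-- A common column becomes a common row after transposition.
... | inj₂ e = CompletelyMeeting.SameRow.impossible (swap ∘ c) (λ eq → c-inj (cong swap eq)) side
                 (λ sp sq → Sum.swap (meet sp sq)) 4<m (subst (_≤ m) (+-comm r s) r+s≤m) sp sq e

-- An obstruction `X` yields `suc n` distinct cells: `a z` for `z` in `X` on one side, `b (g z)` for
-- `z` outside `X` and `b (g x₀)` on the other. The sides meet completely, which is too many cells
-- for that.
pair-apart : ∀ {n r s} (a b : Fin n → Fin r × Fin s) → Inj a → Inj b → (∀ x y → a x ≢ b y) →
  4 ≤ n → r + s ≤ suc n → ∃ λ (g : Fin n → Fin n) → Inj g × (∀ x → Apart (a x) (b (g x)))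
pair-apart {n} {r} {s} a b a-inj b-inj a≢b 4≤n r+s≤1+n = perfect-matching no-obstruction
  where
  open Augment (λ x y → Apart (a x) (b y)) (λ x y → ¬? (_ ≟ _) ×-dec ¬? (_ ≟ _))
  no-obstruction : ∀ g → Inj g → ∀ x₀ → ¬ Obstruction g x₀
  no-obstruction g g-inj x₀ obs =
    completely-meeting-small c c-inj side (λ {p} {q} → meet {p} {q}) {suc x₀} {zero} x₀-side refl (s≤s 4≤n) r+s≤1+n
    where
    open Obstruction obs
    side : Fin (suc n) → Bool
    side zero    = false
    side (suc z) with z ∈? X
    ... | yes _ = true
    ... | no  _ = false
    c : Fin (suc n) → Fin r × Fin s
    c zero    = b (g x₀)
    c (suc z) with z ∈? X
    ... | yes _ = a z
    ... | no  _ = b (g z)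
    x₀-side : side (suc x₀) ≡ true
    x₀-side with x₀ ∈? X
    ... | yes _   = refl
    ... | no x₀∉X = ⊥-elim (x₀∉X x₀∈X)
    meet : ∀ {p q} → side p ≡ true → side q ≡ false → Meet (c p) (c q)
    meet {suc p} {zero} sp sq with p ∈? X
    ... | yes p∈X = ¬apart⇒meet (a p) (b (g x₀)) (¬rel-x₀ p∈X)
    meet {suc p} {suc q} sp sq with p ∈? X | q ∈? X
    ... | yes p∈X | no q∉X = ¬apart⇒meet (a p) (b (g q)) (¬rel p∈X q∉X)
    bg-inj : ∀ {y z} → b (g y) ≡ b (g z) → y ≡ z
    bg-inj eq = g-inj (b-inj eq)
    c-inj : Inj c
    c-inj {zero}  {zero}  _  = refl
    c-inj {zero}  {suc q} eq with q ∈? X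
    ... | yes _   = ⊥-elim (a≢b _ _ (sym eq))
    ... | no  q∉X with bg-inj eq
    ...   | refl = ⊥-elim (q∉X x₀∈X)
    c-inj {suc p} {zero}  eq with p ∈? X
    ... | yes _   = ⊥-elim (a≢b _ _ eq)
    ... | no  p∉X with bg-inj eq
    ...   | refl = ⊥-elim (p∉X x₀∈X)
    c-inj {suc p} {suc q} eq with p ∈? X | q ∈? X
    ... | yes _ | yes _ = cong suc (a-inj eq)
    ... | yes _ | no  _ = ⊥-elim (a≢b _ _ eq)
    ... | no  _ | yes _ = ⊥-elim (a≢b _ _ (sym eq))
    ... | no  _ | no  _ = cong suc (bg-inj eq)

-- Deleting lines

sum-lower : ∀ {n c} (t : Fin n → ℕ) → (∀ i → c ≤ t i) → n * c ≤ sum t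
sum-lower {zero}  t c≤t = z≤n
sum-lower {suc n} t c≤t = +-mono-≤ (c≤t zero) (sum-lower (t ∘ suc) (c≤t ∘ suc))

sum-const : ∀ {n c} (t : Fin n → ℕ) → (∀ i → t i ≡ c) → sum t ≡ n * c
sum-const {zero}  t t≡c = refl
sum-const {suc n} t t≡c = cong₂ _+_ (t≡c zero) (sum-const (t ∘ suc) (t≡c ∘ suc))

sum-∣ : ∀ {n c} (t : Fin n → ℕ) → (∀ i → c ∣ t i) → c ∣ sum t
sum-∣ {zero}  t c∣t = _ ∣0
sum-∣ {suc n} t c∣t = ∣m∣n⇒∣m+n (c∣t zero) (sum-∣ (t ∘ suc) (c∣t ∘ suc))

minimum : ∀ {l} (t : Fin (suc l) → ℕ) → ∃ λ j → ∀ i → t j ≤ t i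
minimum {zero}  t = zero , λ { zero → ≤-refl }
minimum {suc l} t with minimum (t ∘ suc)
... | j , min with ≤-total (t zero) (t (suc j))
...   | inj₁ le = zero  , λ { zero → ≤-refl ; (suc i) → ≤-trans le (min i) }
...   | inj₂ ge = suc j , λ { zero → ge ; (suc i) → min i }

-- Both bounds survive the deletion of the line with the fewest cells of the minority colour `a`:
-- the majority colour has cells to spare, unless there are five lines of length four.
module Deletion {k l : ℕ} (a b : Fin (suc l) → ℕ) (a+b : ∀ j → a j + b j ≡ k) where

  -- `a j` and `b j` count the two colours on line `j`, of length `k`. The `k × l` block left over
  -- must keep `k + l - 1` cells of each.
  Good : Fin (suc l) → Set
  Good j = k + l ≤ suc (sum (removeAt a j)) × k + l ≤ suc (sum (removeAt b j))

  sum-a+b : sum a + sum b ≡ suc l * k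
  sum-a+b = trans (sym (∑-distrib-+ a b)) (sum-const (λ j → a j + b j) a+b)

  -- A line with at most one such cell costs at most the one to spare. Otherwise each of the `l`
  -- other lines has at least two, and `2l` is at least `k + l - 1`.
  minority : k ≤ suc l → k + l ≤ sum a → ∀ j → (∀ i → a j ≤ a i) → k + l ≤ suc (sum (removeAt a j))
  minority k≤1+l k+l≤ j min with a j in aj
  ... | 0 = m≤n⇒m≤1+n (≤-trans k+l≤ (≤-reflexive (trans (sum-remove {i = j} a) (cong (_+ sum (removeAt a j)) aj))))
  ... | 1 = ≤-trans k+l≤ (≤-reflexive (trans (sum-remove {i = j} a) (cong (_+ sum (removeAt a j)) aj)))
  ... | suc (suc x) = begin
    k + l                      ≤⟨ +-monoˡ-≤ l k≤1+l ⟩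
    suc (l + l)                ≡⟨ cong suc (l+l≡l*2 l) ⟩
    suc (l * 2)                ≤⟨ s≤s (sum-lower (removeAt a j) (λ i → ≤-trans (s≤s (s≤s z≤n)) (min (punchIn j i)))) ⟩
    suc (sum (removeAt a j))   ∎
    where
    open ≤-Reasoning
    l+l≡l*2 : ∀ l → l + l ≡ l * 2
    l+l≡l*2 = solve-∀

  -- A line has only `k` cells, so `k` cells to spare suffice for any line.
  majority : k + (k + l) ≤ suc (sum b) → ∀ j → k + l ≤ suc (sum (removeAt b j))
  majority 2k+l≤ j = +-cancelˡ-≤ k _ _ (begin
    k + (k + l)                     ≤⟨ 2k+l≤ ⟩
    suc (sum b)                     ≡⟨ cong suc (sum-remove {i = j} b) ⟩
    suc (b j + sum (removeAt b j))  ≡⟨ +-suc (b j) _ ⟨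
    b j + suc (sum (removeAt b j))  ≤⟨ +-monoˡ-≤ _ (m+n≤o⇒n≤o (a j) (≤-reflexive (a+b j))) ⟩
    k + suc (sum (removeAt b j))    ∎)
    where open ≤-Reasoning

  scarce : sum a ≤ sum b → ¬ (k + (k + l) ≤ suc (sum b)) → 4 + suc l * k ≤ (k + (k + l)) + (k + (k + l))
  scarce a≤b ¬le = begin
    4 + suc l * k                    ≡⟨ cong (4 +_) sum-a+b ⟨
    4 + (sum a + sum b)              ≤⟨ +-monoʳ-≤ 4 (+-monoˡ-≤ (sum b) a≤b) ⟩
    4 + (sum b + sum b)              ≡⟨ shuffle (sum b) ⟩
    (2 + sum b) + (2 + sum b)        ≤⟨ +-mono-≤ (≰⇒> ¬le) (≰⇒> ¬le) ⟩
    (k + (k + l)) + (k + (k + l))    ∎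
    where
    open ≤-Reasoning
    shuffle : ∀ x → 4 + (x + x) ≡ (2 + x) + (2 + x)
    shuffle = solve-∀

  generic : 5 ≤ k → 4 ≤ l → k ≤ suc l → sum a ≤ sum b → k + l ≤ sum a → ∃ Good
  generic 5≤k 4≤l k≤1+l a≤b k+l≤a with minimum a
  ... | j , min with k + (k + l) ≤? suc (sum b)
  ...   | yes le = j , minority k≤1+l k+l≤a j min , majority le j
  ...   | no ¬le = contradiction (scarce a≤b ¬le) (<⇒≱ (dense 5≤k 4≤l))
    where
    -- With `k = 5 + x` and `l = 4 + y` the right side exceeds the successor of the left by
    -- `x + 3y + xy`. At `k = l = 4` both sides are 24, whence the separate case below.
    dense : ∀ {k l} → 5 ≤ k → 4 ≤ l → (k + (k + l)) + (k + (k + l)) < 4 + suc l * k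
    dense {k} {l} 5≤k 4≤l with m≤n⇒∃[o]m+o≡n 5≤k | m≤n⇒∃[o]m+o≡n 4≤l
    ... | x , refl | y , refl = subst (suc (((5 + x) + ((5 + x) + (4 + y))) + ((5 + x) + ((5 + x) + (4 + y)))) ≤_)
      (expand x y) (m≤m+n _ (x + 3 * y + x * y))
      where
      expand : ∀ x y → suc (((5 + x) + ((5 + x) + (4 + y))) + ((5 + x) + ((5 + x) + (4 + y)))) + (x + 3 * y + x * y)
             ≡ 4 + suc (4 + y) * (5 + x)
      expand = solve-∀

-- If all lines were monochromatic, 4 would divide 10.
mixed-line : (a b : Fin 5 → ℕ) → (∀ j → a j + b j ≡ 4) → sum a ≡ 10 → ∃ λ j → 1 ≤ a j × 1 ≤ b j
mixed-line a b a+b a≡10 with any? (λ j → (1 ≤? a j) ×-dec (1 ≤? b j))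
... | yes mixed = mixed
... | no ¬mixed = contradiction (subst (4 ∣_) a≡10 (sum-∣ a mono)) (from-no (4 ∣? 10))
  where
  mono : ∀ j → 4 ∣ a j
  mono j with 1 ≤? a j | 1 ≤? b j
  ... | no 1≰a  | _       = subst (4 ∣_) (sym (n<1⇒n≡0 (≰⇒> 1≰a))) (4 ∣0)
  ... | yes 1≤a | yes 1≤b = contradiction (j , 1≤a , 1≤b) ¬mixed
  ... | yes _   | no 1≰b  = subst (4 ∣_)
    (trans (sym (a+b j)) (trans (cong (a j +_) (n<1⇒n≡0 (≰⇒> 1≰b))) (+-identityʳ (a j)))) ∣-refl

-- With ten cells of each colour the line to delete must not be monochromatic.
five-by-four : (a b : Fin 5 → ℕ) (a+b : ∀ j → a j + b j ≡ 4) → sum a ≤ sum b → 8 ≤ sum a →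
  ∃ (Deletion.Good {4} {4} a b a+b)
five-by-four a b a+b a≤b 8≤a with 12 ≤? suc (sum b)
... | yes le = case minimum a of λ { (j , min) → j , minority (n≤1+n 4) 8≤a j min , majority le j }
  where open Deletion {4} {4} a b a+b
-- Now the majority has at most 10 of the 20 cells, so both colours have exactly 10. A mixed line
-- takes at most three of either and leaves `7 = 4 + 4 - 1`.
... | no ¬le = case mixed-line a b a+b a≡10 of λ { (i , 1≤ai , 1≤bi) →
    i , remaining a i (≤-reflexive (sym a≡10)) (≤3 1≤bi (trans (+-comm (b i) (a i)) (a+b i))) ,
        remaining b i (≤-trans (≤-reflexive (sym a≡10)) a≤b) (≤3 1≤ai (a+b i)) }
  where
  open ≤-Reasoning
  b≤10 : sum b ≤ 10
  b≤10 = ≤-pred (≤-pred (≰⇒> ¬le))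
  a≡10 : sum a ≡ 10
  a≡10 = ≤-antisym (≤-trans a≤b b≤10) (+-cancelʳ-≤ 10 10 (sum a) (begin
    20             ≡⟨ Deletion.sum-a+b {4} {4} a b a+b ⟨
    sum a + sum b  ≤⟨ +-monoʳ-≤ (sum a) b≤10 ⟩
    sum a + 10     ∎))
  ≤3 : ∀ {x y} → 1 ≤ x → x + y ≡ 4 → y ≤ 3
  ≤3 {x} {y} 1≤x eq = ≤-pred (≤-trans (+-monoˡ-≤ y 1≤x) (≤-reflexive eq))
  remaining : ∀ (t : Fin 5 → ℕ) i → 10 ≤ sum t → t i ≤ 3 → 8 ≤ suc (sum (removeAt t i))
  remaining t i 10≤t ti≤3 = s≤s (+-cancelˡ-≤ 3 7 _ (begin
    10                          ≤⟨ 10≤t ⟩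
    sum t                       ≡⟨ sum-remove {i = i} t ⟩
    t i + sum (removeAt t i)    ≤⟨ +-monoˡ-≤ _ ti≤3 ⟩
    3 + sum (removeAt t i)      ∎))

BigEnough : ℕ → ℕ → Set
BigEnough k l = (5 ≤ k × 4 ≤ l) ⊎ (k ≡ 4 × l ≡ 4)

deletable-ordered : ∀ {k l} (a b : Fin (suc l) → ℕ) (a+b : ∀ j → a j + b j ≡ k) → BigEnough k l → k ≤ suc l →
  sum a ≤ sum b → k + l ≤ sum a → ∃ (Deletion.Good {k} {l} a b a+b)
deletable-ordered a b a+b (inj₁ (5≤k , 4≤l)) k≤1+l a≤b k+l≤a = Deletion.generic a b a+b 5≤k 4≤l k≤1+l a≤b k+l≤a
deletable-ordered a b a+b (inj₂ (refl , refl)) k≤1+l a≤b k+l≤a = five-by-four a b a+b a≤b k+l≤a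

deletable : ∀ {k l} (a b : Fin (suc l) → ℕ) (a+b : ∀ j → a j + b j ≡ k) → BigEnough k l → k ≤ suc l →
  k + l ≤ sum a → k + l ≤ sum b → ∃ (Deletion.Good {k} {l} a b a+b)
deletable a b a+b big k≤1+l k+l≤a k+l≤b with ≤-total (sum a) (sum b)
... | inj₁ a≤b = deletable-ordered a b a+b big k≤1+l a≤b k+l≤a
... | inj₂ b≤a with deletable-ordered b a (λ j → trans (+-comm (b j) (a j)) (a+b j)) big k≤1+l b≤a k+l≤b
...   | j , good-b , good-a = j , good-a , good-b

-- Counting and listing the cells of a colour

indicator : Colour → Colour → ℕ
indicator c d = if does (isC c d) then 1 else 0

indicator-sum : ∀ d → indicator c1 d + indicator c2 d ≡ 1
indicator-sum c1 = refl
indicator-sum c2 = refl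

count : ∀ {k l} → (Fin k → Fin l → Colour) → Colour → ℕ
count F c = sum λ i → sum λ j → indicator c (F i j)

cellsOf : ∀ {k l} → (Fin k → Fin l → Colour) → Colour → List (Fin k × Fin l)
cellsOf {k} {l} F c = filter (λ e → isC c (F (proj₁ e) (proj₂ e))) (cartesianProduct (allFin k) (allFin l))

-- The induction runs over reindexings `h`, since the tail of a tabulated list is tabulated by
-- `h ∘ suc`.
length-cellsOf : ∀ {k l} (F : Fin k → Fin l → Colour) c → length (cellsOf F c) ≡ count F c
length-cellsOf {k} {l} F c = rows id
  where
  P? = λ (e : Fin k × Fin l) → isC c (F (proj₁ e) (proj₂ e))
  row : ∀ i {m} (h : Fin m → Fin l) → length (filter P? (map (i ,_) (tabulate h))) ≡ sum (λ j → indicator c (F i (h j)))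
  row i {zero}  h = refl
  row i {suc m} h with does (isC c (F i (h zero)))
  ... | true  = cong suc (row i (h ∘ suc))
  ... | false = row i (h ∘ suc)
  rows : ∀ {m} (h : Fin m → Fin k) → length (filter P? (cartesianProduct (tabulate h) (allFin l))) ≡ count (F ∘ h) c
  rows {zero}  h = refl
  rows {suc m} h = begin
    length (filter P? (xs ++ ys))                   ≡⟨ cong length (filter-++ P? xs ys) ⟩
    length (filter P? xs ++ filter P? ys)           ≡⟨ length-++ (filter P? xs) ⟩
    length (filter P? xs) + length (filter P? ys)   ≡⟨ cong₂ _+_ (row (h zero) id) (rows (h ∘ suc)) ⟩
    count (F ∘ h) c                                 ∎
    where
    open ≡-Reasoning
    xs = map (h zero ,_) (allFin l)
    ys = cartesianProduct (tabulate (h ∘ suc)) (allFin l)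

lookup-injective : ∀ {A : Set} {xs : List A} → Unique xs → Inj (lookup xs)
lookup-injective (_   ∷ _)  {zero}  {zero}  _  = refl
lookup-injective (x≢ ∷ _)  {zero}  {suc j} eq = ⊥-elim (All.lookup x≢ (∈-lookup j) eq)
lookup-injective (x≢ ∷ _)  {suc i} {zero}  eq = ⊥-elim (All.lookup x≢ (∈-lookup i) (sym eq))
lookup-injective (_   ∷ u)  {suc i} {suc j} eq = cong suc (lookup-injective u eq)

enumerate : ∀ {k l n} (F : Fin k → Fin l → Colour) c → n ≤ count F c →
  ∃ λ (t : Fin n → Fin k × Fin l) → Inj t × (∀ x → F (proj₁ (t x)) (proj₂ (t x)) ≡ c)
enumerate {k} {l} {n} F c n≤ =
  (λ x → lookup xs (inject≤ x n≤len)) ,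
  (λ eq → inject≤-injective n≤len n≤len _ _ (lookup-injective xs-unique eq)) ,
  λ x → proj₂ (∈-filter⁻ (λ e → isC c (F (proj₁ e) (proj₂ e))) {xs = cartesianProduct (allFin k) (allFin l)}
    (∈-lookup (inject≤ x n≤len)))
  where
  xs = cellsOf F c
  n≤len : n ≤ length xs
  n≤len = subst (n ≤_) (sym (length-cellsOf F c)) n≤
  xs-unique : Unique xs
  xs-unique = Unique.filter⁺ _ (Unique.cartesianProduct⁺ (Unique.allFin⁺ k) (Unique.allFin⁺ l))

-- Shrinking the block

exclude : ∀ {k k̄} → Fin (suc k) → Fin k ⊎ Fin (suc k̄) → Fin (suc k) ⊎ Fin k̄
exclude j (inj₁ i)       = inj₁ (punchIn j i)
exclude j (inj₂ zero)    = inj₁ j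
exclude j (inj₂ (suc i)) = inj₂ i

exclude-injective : ∀ {k k̄} (j : Fin (suc k)) → Inj (exclude {k} {k̄} j)
exclude-injective j {inj₁ x}       {inj₁ y}       eq = cong inj₁ (punchIn-injective j x y (inj₁-injective eq))
exclude-injective j {inj₁ x}       {inj₂ zero}    eq = ⊥-elim (punchInᵢ≢i j x (inj₁-injective eq))
exclude-injective j {inj₂ zero}    {inj₁ y}       eq = ⊥-elim (punchInᵢ≢i j y (inj₁-injective (sym eq)))
exclude-injective j {inj₂ zero}    {inj₂ zero}    eq = refl
exclude-injective j {inj₂ (suc x)} {inj₂ (suc y)} eq = cong (inj₂ ∘ suc) (inj₂-injective eq)

-- k chosen rows and l chosen columns; k̄ and l̄ enumerate the rows and columns left out.
record Block {n} (f : Colouring n) (k k̄ l l̄ : ℕ) : Set where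
  field
    rows     : Fin k ⊎ Fin k̄ → Fin n
    rows-inj : Inj rows
    cols     : Fin l ⊎ Fin l̄ → Fin n
    cols-inj : Inj cols
  entry : Fin k → Fin l → Colour
  entry i j = f (rows (inj₁ i) , cols (inj₁ j))
  field
    many : ∀ c → k + l ≤ suc (count entry c)

transposed : ∀ {n} {f : Colouring n} {k k̄ l l̄} → Block f k k̄ l l̄ → Block (f ∘ swap) l l̄ k k̄
transposed {k = k} {l = l} B = record
  { rows = cols ; rows-inj = cols-inj ; cols = rows ; cols-inj = rows-inj
  ; many = λ c → subst₂ _≤_ (+-comm k l) (cong suc (∑-comm (λ i j → indicator c (entry i j)))) (many c) }
  where open Block B

delete-col : ∀ {n} {f : Colouring n} {k k̄ l l̄} → BigEnough k l → k ≤ suc l →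
             Block f k k̄ (suc l) l̄ → Block f k k̄ l (suc l̄)
delete-col {f = f} {k} {k̄} {l} {l̄} big k≤1+l B =
  case deletable (colSum c1) (colSum c2) total big k≤1+l (enough c1) (enough c2) of λ { (p , good₁ , good₂) → record
    { rows     = rows
    ; rows-inj = rows-inj
    ; cols     = cols ∘ exclude p
    ; cols-inj = λ eq → exclude-injective p (cols-inj eq)
    ; many     = λ { c1 → remaining c1 p good₁ ; c2 → remaining c2 p good₂ } } }
  where
  open Block B
  colSum : Colour → Fin (suc l) → ℕ
  colSum c j = sum λ i → indicator c (entry i j)
  total : ∀ j → colSum c1 j + colSum c2 j ≡ k
  total j = trans (sym (∑-distrib-+ (λ i → indicator c1 (entry i j)) (λ i → indicator c2 (entry i j))))
    (trans (sum-const (λ i → indicator c1 (entry i j) + indicator c2 (entry i j)) (λ i → indicator-sum (entry i j)))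
           (*-identityʳ k))
  enough : ∀ c → k + l ≤ sum (colSum c)
  enough c = ≤-pred (subst₂ _≤_ (+-suc k l) (cong suc (∑-comm (λ i j → indicator c (entry i j)))) (many c))
  remaining : ∀ c p → k + l ≤ suc (sum (removeAt (colSum c) p)) →
              k + l ≤ suc (count (λ i j → entry i (punchIn p j)) c)
  remaining c p = subst (λ x → k + l ≤ suc x) (sym (∑-comm (λ i j → indicator c (entry i (punchIn p j)))))

delete-row : ∀ {n} {f : Colouring n} {k k̄ l l̄} → BigEnough l k → l ≤ suc k →
             Block f (suc k) k̄ l l̄ → Block f k (suc k̄) l l̄
delete-row big l≤1+k B = transposed (delete-col big l≤1+k (transposed B))

-- The bound on the colour classes is exactly the invariant `many` for `k = l = n`.
whole : ∀ {n} (f : Colouring n) → (∀ c → 2 * n ∸ 1 ≤ colourClassSize f c) → Block f n 0 n 0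
whole {n} f large = record
  { rows = [ id , (λ ()) ]′ ; rows-inj = id-inj ; cols = [ id , (λ ()) ]′ ; cols-inj = id-inj
  ; many = λ c → begin
      n + n                    ≡⟨ cong (n +_) (+-identityʳ n) ⟨
      2 * n                    ≤⟨ m≤n+m∸n (2 * n) 1 ⟩
      suc (2 * n ∸ 1)          ≤⟨ s≤s (large c) ⟩
      suc (colourClassSize f c) ≡⟨ cong suc (length-cellsOf (λ i j → f (i , j)) c) ⟩
      suc (count (λ i j → f (i , j)) c) ∎ }
  where
  open ≤-Reasoning
  id-inj : Inj {Fin n ⊎ Fin 0} [ id , (λ ()) ]′
  id-inj {inj₁ x} {inj₁ y} eq = cong inj₁ eq

-- `m` counts the deletions still to come. A square block loses a column, a block with one extra row
-- loses a row, so the lines deleted are never longer than their number.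
shrink : ∀ {n} {f : Colouring n} → 7 ≤ n → ∀ m {k k̄ l l̄} → k + k̄ ≡ n → l + l̄ ≡ n → k + l ≡ suc n + m →
  k ≡ l ⊎ k ≡ suc l → Block f k k̄ l l̄ → ∃ λ d → ∃ λ e → n ≡ suc (d + e) × Block f (suc d) e (suc e) d
shrink {n} 7≤n zero {k} {k̄} {l} {l̄} kk̄ ll̄ kl shape B = l̄ , k̄ , n≡ , subst₂ (λ x y → Block _ x k̄ y l̄) k≡ l≡ B
  where
  kl′ : k + l ≡ suc n
  kl′ = trans kl (+-identityʳ (suc n))
  k≡ : k ≡ suc l̄
  k≡ = +-cancelʳ-≡ l k (suc l̄) (trans kl′ (cong suc (trans (sym ll̄) (+-comm l l̄))))
  l≡ : l ≡ suc k̄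
  l≡ = +-cancelˡ-≡ k l (suc k̄) (trans kl′ (trans (cong suc (sym kk̄)) (sym (+-suc k k̄))))
  n≡ : n ≡ suc (l̄ + k̄)
  n≡ = trans (sym kk̄) (cong (_+ k̄) k≡)
shrink {n} 7≤n (suc m) {k} {k̄} {zero} kk̄ ll̄ kl (inj₁ refl) B = case kl of λ ()
shrink {n} 7≤n (suc m) {k} {k̄} {suc l} {l̄} kk̄ ll̄ kl (inj₁ refl) B =
  shrink 7≤n m kk̄ (trans (+-suc l l̄) ll̄) (suc-injective (trans (sym (cong suc (+-suc l l))) (trans kl (+-suc (suc n) m))))
    (inj₂ refl) (delete-col (inj₁ (s≤s 4≤l , 4≤l)) ≤-refl B)
  where
  -- As long as a line is to be deleted, the block has at least `n + 2`, hence 9, lines; a square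
  -- one then has side at least 5.
  4≤l : 4 ≤ l
  4≤l with 4 ≤? l
  ... | yes p = p
  ... | no ¬p = contradiction (begin
    9                ≤⟨ s≤s (s≤s 7≤n) ⟩
    suc (suc n)      ≤⟨ s≤s (s≤s (m≤m+n n m)) ⟩
    suc (suc n + m)  ≡⟨ trans kl (+-suc (suc n) m) ⟨
    suc l + suc l    ≤⟨ +-mono-≤ (≰⇒> ¬p) (≰⇒> ¬p) ⟩
    8                ∎) (<⇒≱ ≤-refl)
    where open ≤-Reasoning
shrink {n} 7≤n (suc m) {_} {k̄} {l} {l̄} kk̄ ll̄ kl (inj₂ refl) B =
  shrink 7≤n m (trans (+-suc l k̄) kk̄) ll̄ (suc-injective (trans kl (+-suc (suc n) m))) (inj₁ refl)
    (delete-row big (n≤1+n l) B)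
  where
  -- Nine lines in an `suc l × l` block only force `l` to be at least 4; the value 4 is the
  -- exceptional block of five rows of length four.
  big : BigEnough l l
  big with 5 ≤? l
  ... | yes 5≤l = inj₁ (5≤l , ≤-trans (n≤1+n 4) 5≤l)
  ... | no 5≰l with 4 ≤? l
  ...   | yes 4≤l = let l≡4 = ≤-antisym (≤-pred (≰⇒> 5≰l)) 4≤l in inj₂ (l≡4 , l≡4)
  ...   | no 4≰l = contradiction (begin
    9                ≤⟨ s≤s (s≤s 7≤n) ⟩
    suc (suc n)      ≤⟨ s≤s (s≤s (m≤m+n n m)) ⟩
    suc (suc n + m)  ≡⟨ trans kl (+-suc (suc n) m) ⟨
    suc l + l        ≤⟨ +-mono-≤ (≰⇒> 4≰l) (≤-pred (≰⇒> 4≰l)) ⟩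
    7                ∎) (<⇒≱ (n≤1+n 8))
    where open ≤-Reasoning

-- From paired cells to the partition

module _ {r s n : ℕ} (a b : Fin n → Fin r × Fin s) (a-inj : Inj a) (b-inj : Inj b)
         (a≢b : ∀ x y → a x ≢ b y) (apart : ∀ x → Apart (a x) (b x)) where

  Labelled : Fin r → Fin s → Fin n → Set
  Labelled i j k = a k ≡ (i , j) ⊎ b k ≡ (i , j)

  labelled? : ∀ i j → Dec (∃ (Labelled i j))
  labelled? i j = any? (λ k → ×-≡-dec _≟_ _≟_ (a k) (i , j) ⊎-dec ×-≡-dec _≟_ _≟_ (b k) (i , j))

  label : PartialColouring {r} {s} {n}
  label i j with labelled? i j
  ... | yes (k , _) = just k
  ... | no  _       = nothing

  label-just : ∀ i j {k} → label i j ≡ just k → Labelled i j k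
  label-just i j p with labelled? i j
  label-just i j refl | yes (k , q) = q

  label-unique : ∀ {i j k l} → Labelled i j k → Labelled i j l → k ≡ l
  label-unique (inj₁ p) (inj₁ q) = a-inj (trans p (sym q))
  label-unique (inj₁ p) (inj₂ q) = ⊥-elim (a≢b _ _ (trans p (sym q)))
  label-unique (inj₂ p) (inj₁ q) = ⊥-elim (a≢b _ _ (trans q (sym p)))
  label-unique (inj₂ p) (inj₂ q) = b-inj (trans p (sym q))

  label-complete : ∀ {i j k} → Labelled i j k → label i j ≡ just k
  label-complete {i} {j} q with labelled? i j
  ... | yes (l , q′) = cong just (label-unique q′ q)
  ... | no ¬q        = ⊥-elim (¬q (_ , q))

  label-apart : ∀ {i j i′ j′ k} → Labelled i j k → Labelled i′ j′ k → (i , j) ≡ (i′ , j′) ⊎ Apart (i , j) (i′ , j′)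
  label-apart (inj₁ p) (inj₁ q) = inj₁ (trans (sym p) q)
  label-apart (inj₂ p) (inj₂ q) = inj₁ (trans (sym p) q)
  label-apart {k = k} (inj₁ p) (inj₂ q) = inj₂ (subst₂ Apart p q (apart k))
  label-apart {k = k} (inj₂ p) (inj₁ q) =
    inj₂ (subst₂ Apart p q ((λ e → proj₁ (apart k) (sym e)) , λ e → proj₂ (apart k) (sym e)))

  label-proper : Proper label
  label-proper = record
    { row = λ {i} {j} {j′} p q → case label-apart (label-just i j p) (label-just i j′ q) of λ
        { (inj₁ e) → cong proj₂ e ; (inj₂ (i≢i , _)) → ⊥-elim (i≢i refl) }
    ; col = λ {i} {i′} {j} p q → case label-apart (label-just i j p) (label-just i′ j q) of λ
        { (inj₁ e) → cong proj₁ e ; (inj₂ (_ , j≢j)) → ⊥-elim (j≢j refl) } }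

-- `R v x` is the row of symbol `x` in column `v`; inverting the permutation `R v` gives the symbol
-- of the cell `(u , v)`, which is the class of that edge.
latin⇒partition : ∀ {n} (f : Colouring n) (R : Fin n → Fin n → Fin n) →
  (∀ v → Inj (R v)) → (∀ x → Inj (λ v → R v x)) →
  (∀ x c → ∃ λ v → f (R v x , v) ≡ c) → PartitionIntoBalancedMatchings f
latin⇒partition {n} f R R-row R-col hits = g , λ k → matching k , balanced k
  where
  g : Edge n → Fin n
  g (u , v) = proj₁ (injective⇒surjective (R v) (R-row v) u)
  g-spec : ∀ e {k} → g e ≡ k → R (proj₂ e) k ≡ proj₁ e
  g-spec (u , v) refl = proj₂ (injective⇒surjective (R v) (R-row v) u)
  g-edge : ∀ v k → g (R v k , v) ≡ k
  g-edge v k = R-row v (g-spec (R v k , v) refl)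
  matching : ∀ k → IsMatching (λ e → g e ≡ k)
  matching k e@(u , v) e′@(u′ , v′) p q e≢e′ =
    (λ { refl → e≢e′ (cong (u ,_) (R-col k (trans (g-spec e p) (sym (g-spec e′ q))))) }) ,
    (λ { refl → e≢e′ (cong (_, v) (trans (sym (g-spec e p)) (g-spec e′ q))) })
  balanced : ∀ k → IsBalanced f (λ e → g e ≡ k)
  balanced k = hit c1 , hit c2
    where
    hit : ∀ c → ∃ λ e → g e ≡ k × f e ≡ c
    hit c with hits k c
    ... | v , p = (R v k , v) , g-edge v k , p

block⇒partition : ∀ {d e} (f : Colouring (suc (d + e))) → 4 ≤ suc (d + e) → Block f (suc d) e (suc e) d →
  PartitionIntoBalancedMatchings f
block⇒partition {d} {e} f 4≤n B =
  case enumerate entry c1 (enough c1) of λ { (a , a-inj , a-c1) →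
  case enumerate entry c2 (enough c2) of λ { (b , b-inj , b-c2) →
  let a≢b : ∀ x y → a x ≢ b y
      a≢b x y eq = c1≢c2 (trans (sym (a-c1 x)) (trans (cong (λ t → entry (proj₁ t) (proj₂ t)) eq) (b-c2 y)))
  in case pair-apart a b a-inj b-inj a≢b 4≤n sizes of λ { (g , g-inj , apart) →
  let b′ = b ∘ g
      b′-inj : Inj b′
      b′-inj = λ eq → g-inj (b-inj eq)
      φ = label a b′ a-inj b′-inj (λ x y → a≢b x (g y)) apart
      φ-complete : ∀ {i j k} → a k ≡ (i , j) ⊎ b′ k ≡ (i , j) → φ i j ≡ just k
      φ-complete = label-complete a b′ a-inj b′-inj (λ x y → a≢b x (g y)) apart
  in case fill φ (label-proper a b′ a-inj b′-inj (λ x y → a≢b x (g y)) apart) sizes of λ { (Q , Q-row , Q-col , Q-keeps) →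
  let Q-a : ∀ k → Q (proj₁ (a k)) (proj₂ (a k)) ≡ k
      Q-a k = Q-keeps (φ-complete (inj₁ refl))
      Q-b : ∀ k → Q (proj₁ (b′ k)) (proj₂ (b′ k)) ≡ k
      Q-b k = Q-keeps (φ-complete (inj₂ refl))
  -- Symbol `k` occurs in the block at the cell `a k`.
  in case ryser Q Q-row Q-col (λ k → proj₁ (a k) , proj₂ (a k) , Q-a k) rows rows-inj cols cols-inj of λ
    { (R , R-row , R-col , R-keeps) →
  let hit : ∀ {i j k c} → Q i j ≡ k → entry i j ≡ c → ∃ λ v → f (R v k , v) ≡ c
      hit {i} {j} = λ { refl p → cols (inj₁ j) , trans (cong (λ u → f (u , cols (inj₁ j))) (R-keeps i j)) p }
  in latin⇒partition f R R-row R-col λ { k c1 → hit (Q-a k) (a-c1 k) ; k c2 → hit (Q-b k) (b-c2 (g k)) } } } } } }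
  where
  open Block B
  c1≢c2 : c1 ≢ c2
  c1≢c2 ()
  sizes : suc d + suc e ≤ suc (suc (d + e))
  sizes = ≤-reflexive (+-suc (suc d) e)
  enough : ∀ c → suc (d + e) ≤ count entry c
  enough c = ≤-pred (subst (_≤ suc (count entry c)) (+-suc (suc d) e) (many c))

theorem5 : (n : ℕ) → 7 ≤ n → (f : Colouring n) →
    2 * n ∸ 1 ≤ colourClassSize f c1 →
    2 * n ∸ 1 ≤ colourClassSize f c2 →
    PartitionIntoBalancedMatchings f
theorem5 (suc n) 7≤n f large₁ large₂ =
  -- The square has order `suc n`, so `n` deletions take its `2 * suc n` lines down to
  -- `suc (suc n)`.
  case shrink {f = f} 7≤n n (+-identityʳ (suc n)) (+-identityʳ (suc n)) (+-suc (suc n) n) (inj₁ refl)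
    (whole f λ { c1 → large₁ ; c2 → large₂ }) of λ
    { (d , e , refl , B) → block⇒partition f (≤-trans (s≤s (s≤s (s≤s (s≤s z≤n)))) 7≤n) B }
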